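{- For $3\le D\le 20000$ there is no graph of degree $5$, diameter $D$ and cyclic defect. Furthermore, for odd $g$ with $7\le g\le 40001$ there is no graph of degree $5$, girth $g$ and cyclic excess.
   Context: For an integer $d\ge 1$ define polynomials $G_{d,m}(x)$ by $G_{d,0}(x)=1$, $G_{d,1}(x)=x+1$, and $G_{d,m+1}(x)=xG_{d,m}(x)-(d-1)G_{d,m-1}(x)$ for $m\ge1$. Let $J_n$ be the $n\times n$ all-ones matrix. For a graph on $n\ge3$ vertices, a cycle matrix is the adjacency matrix $B$ of an $n$-cycle on the same vertex set (i.e., for some ordering $v_1,\dots,v_n$ of the vertices, $B_{ij}=1$ iff $v_i,v_j$ are cyclically consecutive, and $0$ otherwise); this cycle need not consist of edges of the graph. A graph $\Gamma$ of order $n$ with adjacency matrix $A$ is a graph of degree $d$, diameter $D$ and cyclic defect if $\Gamma$ is $d$-regular with $d\ge3$, has diameter $D\ge2$, and $G_{d,D}(A)=J_n+B$ for some cycle matrix $B$. It is a graph of degree $d$, girth $g$ and cyclic excess if $\Gamma$ is $d$-regular with $d\ge3$, has odd girth $g\ge5$, and $G_{d,\lfloor g/2\rfloor}(A)=J_n-B$ for some cycle matrix $B$. -}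

module Defs where

open import Data.Nat using (ℕ; zero; suc; _≤_; _<_; s≤s; _∸_)
import Data.Nat as ℕ
open import Data.Nat.DivMod using (_/_; _%_)
open import Data.Integer using (ℤ; +_; _+_; _-_; _*_; 0ℤ; 1ℤ)
open import Data.Fin using (Fin; zero; suc; toℕ; fromℕ<)
open import Data.Fin.Permutation using (Permutation′; _⟨$⟩ʳ_; _⟨$⟩ˡ_)
import Data.Fin as Fin
open import Data.Bool using (Bool; true; false; if_then_else_; _∨_)
open import Data.Product using (Σ; ∃; ∃-syntax; _×_; _,_)
open import Function.Definitions using (Injective)
open import Relation.Binary.PropositionalEquality using (_≡_)
open import Relation.Nullary using (¬_; yes; no; does)

record Graph (n : ℕ) : Set where
  field
    adj     : Fin n → Fin n → Bool
    adj-sym : ∀ i j → adj i j ≡ adj j i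
    loopless : ∀ i → adj i i ≡ false
open Graph public

Mat : ℕ → Set
Mat n = Fin n → Fin n → ℤ

sumFin : ∀ {n} → (Fin n → ℤ) → ℤ
sumFin {zero}  f = 0ℤ
sumFin {suc n} f = f zero + sumFin (λ i → f (suc i))

_⊕_ : ∀ {n} → Mat n → Mat n → Mat n
(A ⊕ B) i j = A i j + B i j

_⊖_ : ∀ {n} → Mat n → Mat n → Mat n
(A ⊖ B) i j = A i j - B i j

_⊗_ : ∀ {n} → Mat n → Mat n → Mat n
(A ⊗ B) i j = sumFin (λ k → A i k * B k j)

_·ₘ_ : ∀ {n} → ℤ → Mat n → Mat n
(c ·ₘ A) i j = c * A i j

Iₘ : ∀ {n} → Mat n
Iₘ i j = if does (i Fin.≟ j) then 1ℤ else 0ℤ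

Jₘ : ∀ {n} → Mat n
Jₘ i j = 1ℤ

_≈ₘ_ : ∀ {n} → Mat n → Mat n → Set
A ≈ₘ B = ∀ i j → A i j ≡ B i j

adjMat : ∀ {n} → Graph n → Mat n
adjMat G i j = if adj G i j then 1ℤ else 0ℤ

Gpoly : ℕ → ℕ → ∀ {n} → Mat n → Mat n
Gpoly d zero          A = Iₘ
Gpoly d (suc zero)    A = A ⊕ Iₘ
Gpoly d (suc (suc m)) A = (A ⊗ Gpoly d (suc m) A) ⊖ ((+ (d ∸ 1)) ·ₘ Gpoly d m A)

cycSucc : ∀ {m} → Fin m → Fin m
cycSucc {suc k} i with toℕ i ℕ.<? k
... | yes p = fromℕ< (s≤s p)
... | no _  = zero

-- Cycle matrix: adjacency matrix of the n-cycle v_1 ... v_n, where the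
-- ordering is given by a permutation π (position p holds vertex π⟨$⟩ʳ p).
cycleMat : ∀ {n} → Permutation′ n → Mat n
cycleMat π i j =
  if does (cycSucc (π ⟨$⟩ˡ i) Fin.≟ (π ⟨$⟩ˡ j)) ∨ does (cycSucc (π ⟨$⟩ˡ j) Fin.≟ (π ⟨$⟩ˡ i))
  then 1ℤ else 0ℤ

IsCycleMatrix : ∀ {n} → Mat n → Set
IsCycleMatrix {n} B = 3 ≤ n × ∃[ π ] (B ≈ₘ cycleMat π)

degree : ∀ {n} → Graph n → Fin n → ℤ
degree G i = sumFin (λ j → adjMat G i j)

Regular : ℕ → ∀ {n} → Graph n → Set
Regular d G = ∀ i → degree G i ≡ + d

data Walk {n} (G : Graph n) : ℕ → Fin n → Fin n → Set where
  here : ∀ {u} → Walk G 0 u u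
  step : ∀ {k u v w} → adj G u v ≡ true → Walk G k v w → Walk G (suc k) u w

HasDiameter : ∀ {n} → Graph n → ℕ → Set
HasDiameter {n} G D =
  (∀ (u v : Fin n) → ∃[ k ] (k ≤ D × Walk G k u v)) ×
  (∃[ u ] ∃[ v ] (∀ k → Walk G k u v → D ≤ k))

HasCycle : ∀ {n} → Graph n → ℕ → Set
HasCycle {n} G m =
  3 ≤ m × Σ (Fin m → Fin n) (λ f → Injective _≡_ _≡_ f × (∀ i → adj G (f i) (f (cycSucc i)) ≡ true))

HasGirth : ∀ {n} → Graph n → ℕ → Set
HasGirth G g = HasCycle G g × (∀ m → m < g → ¬ HasCycle G m)

Odd : ℕ → Set
Odd g = g % 2 ≡ 1

CyclicDefect : ℕ → ℕ → ∀ {n} → Graph n → Set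
CyclicDefect d D G =
  3 ≤ d × Regular d G × 2 ≤ D × HasDiameter G D ×
  ∃[ B ] (IsCycleMatrix B × (Gpoly d D (adjMat G) ≈ₘ (Jₘ ⊕ B)))

CyclicExcess : ℕ → ℕ → ∀ {n} → Graph n → Set
CyclicExcess d g G =
  3 ≤ d × Regular d G × Odd g × 5 ≤ g × HasGirth G g ×
  ∃[ B ] (IsCycleMatrix B × (Gpoly d (g / 2) (adjMat G) ≈ₘ (Jₘ ⊖ B)))

{-# OPTIONS --safe #-}
-- Write A for the adjacency matrix and G(A) = J + εB with ε = ±1. Since A commutes
-- with J it commutes with B, so it preserves the eigenspaces of B. The row sums give
-- n = G(5) - 2ε, which is divisible by 4, so B has the simple eigenvalue -2, on the
-- vector alternating in sign along the cycle. That vector is then an eigenvector of A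
-- whose eigenvalue θ is odd with |θ| ≤ 5, and G(θ) = -2ε. Running the recurrence up to
-- 20000 leaves only θ = 1, D = 4 for the defect and θ = -3, g = 7 or 15 for the excess.
-- In these cases one uses the two-dimensional kernel of B: A acts on it by an integral
-- 2×2 matrix M with G(M) = 0, and there is no such matrix modulo 3 or modulo 5.
module Submission where

open import Defs
open import Data.Bool using (Bool; true; false; if_then_else_; _∨_)
open import Data.Fin using (Fin; zero; suc; toℕ; fromℕ; fromℕ<; inject₁)
import Data.Fin as Fin
open import Data.Fin.Induction using (<-weakInduction)
open import Data.Fin.Permutation using (Permutation′; _⟨$⟩ʳ_; _⟨$⟩ˡ_; inverseˡ; inverseʳ)
open import Data.Fin.Properties using (all?; toℕ-fromℕ; toℕ-fromℕ<; toℕ-inject₁; toℕ-injective; toℕ<n; suc-injective)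
open import Data.Fin.Relation.Unary.Top using (view; ‵fromℕ; ‵inject₁)
open import Data.Integer using (ℤ; +_; _+_; _-_; _*_; -_; 0ℤ; 1ℤ; -1ℤ; _%ℕ_; _/ℕ_)
open import Data.Integer.DivMod using (n%ℕd<d; a≡a%ℕn+[a/ℕn]*n)
open import Data.Integer.Divisibility.Signed using (_∣_; divides; _∣?_; ∣m∣n⇒∣m+n; ∣m∣n⇒∣m-n; ∣m⇒∣m*n; ∣n⇒∣m*n; ∣⇒∣ᵤ)
import Data.Integer.Properties as ℤ
import Data.Nat.Divisibility as ℕ
open import Data.Integer.Tactic.RingSolver using (solve-∀)
open import Data.List using (List; []; _∷_)
open import Data.List.Membership.Propositional using (_∈_)
open import Data.List.Relation.Unary.Any using (here; there)
open import Data.Nat using (ℕ; zero; suc; _≤_; _<_; s≤s; NonZero)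
import Data.Nat as ℕ
import Data.Nat.Properties as ℕ
open import Data.Product using (∃₂; ∃-syntax; _×_; _,_; proj₁)
open import Data.Sum using (_⊎_; inj₁; inj₂)
open import Data.Nat.DivMod using (_/_; /-monoˡ-≤)
open import Function using (_∘_; mk⇔; case_of_)
open import Relation.Binary.PropositionalEquality using (_≡_; _≢_; refl; sym; trans; cong; cong₂; subst; module ≡-Reasoning)
open import Relation.Nullary using (¬_; Dec; yes; no; does; ¬?; contradiction)
open import Relation.Nullary.Decidable using (from-yes; does-⇔)

open import Algebra.Properties.AbelianGroup ℤ.+-0-abelianGroup using (∙-cancelˡ)

open ≡-Reasoning

private
  variable
    l m n r d : ℕ

-- Finite sums

sum-cong : {f g : Fin n → ℤ} → (∀ i → f i ≡ g i) → sumFin f ≡ sumFin g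
sum-cong {zero}  eq = refl
sum-cong {suc n} eq = cong₂ _+_ (eq zero) (sum-cong (eq ∘ suc))

sum-zero : ∀ n → sumFin {n} (λ _ → 0ℤ) ≡ 0ℤ
sum-zero zero    = refl
sum-zero (suc n) = trans (ℤ.+-identityˡ _) (sum-zero n)

sum-one : ∀ n → sumFin {n} (λ _ → 1ℤ) ≡ + n
sum-one zero    = refl
sum-one (suc n) = cong (λ s → 1ℤ + s) (sum-one n)

sum-+ : (f g : Fin n → ℤ) → sumFin (λ i → f i + g i) ≡ sumFin f + sumFin g
sum-+ {zero}  f g = refl
sum-+ {suc n} f g = trans (cong (_+_ (f zero + g zero)) (sum-+ (f ∘ suc) (g ∘ suc)))
                          (lemma (f zero) (g zero) _ _)
  where
  lemma : ∀ a b c e → (a + b) + (c + e) ≡ (a + c) + (b + e)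
  lemma = solve-∀

sum-*ˡ : ∀ c (f : Fin n → ℤ) → sumFin (λ i → c * f i) ≡ c * sumFin f
sum-*ˡ {zero}  c f = sym (ℤ.*-zeroʳ c)
sum-*ˡ {suc n} c f = trans (cong (_+_ (c * f zero)) (sum-*ˡ c (f ∘ suc)))
                           (sym (ℤ.*-distribˡ-+ c (f zero) _))

sum-*ʳ : ∀ c (f : Fin n → ℤ) → sumFin (λ i → f i * c) ≡ sumFin f * c
sum-*ʳ c f = trans (sum-cong (λ i → ℤ.*-comm (f i) c)) (trans (sum-*ˡ c f) (ℤ.*-comm c _))

sum-- : (f g : Fin n → ℤ) → sumFin (λ i → f i - g i) ≡ sumFin f - sumFin g
sum-- f g = trans (sum-+ f (λ i → - g i)) (cong (_+_ (sumFin f)) negated)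
  where
  negated : sumFin (λ i → - g i) ≡ - sumFin g
  negated = trans (sum-cong (λ i → sym (ℤ.-1*i≡-i (g i))))
                  (trans (sum-*ˡ -1ℤ g) (ℤ.-1*i≡-i (sumFin g)))

sum-swap : (f : Fin m → Fin n → ℤ) →
           sumFin (λ i → sumFin (λ j → f i j)) ≡ sumFin (λ j → sumFin (λ i → f i j))
sum-swap {zero}  {n} f = sym (sum-zero n)
sum-swap {suc m} {n} f = trans (cong (_+_ (sumFin (f zero))) (sum-swap (f ∘ suc)))
                               (sym (sum-+ (f zero) _))

sum-Iˡ : (i : Fin n) (x : Fin n → ℤ) → sumFin (λ j → Iₘ i j * x j) ≡ x i
sum-Iˡ {suc n} zero x = begin
  1ℤ * x zero + sumFin (λ j → 0ℤ * x (suc j))  ≡⟨ cong₂ _+_ (ℤ.*-identityˡ (x zero)) (trans (sum-cong (λ j → ℤ.*-zeroˡ (x (suc j)))) (sum-zero n)) ⟩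
  x zero + 0ℤ                                  ≡⟨ ℤ.+-identityʳ _ ⟩
  x zero                                       ∎
sum-Iˡ {suc n} (suc i) x = begin
  0ℤ * x zero + sumFin (λ j → Iₘ (suc i) (suc j) * x (suc j))  ≡⟨ cong₂ _+_ (ℤ.*-zeroˡ (x zero)) (sum-Iˡ i (x ∘ suc)) ⟩
  0ℤ + x (suc i)                                               ≡⟨ ℤ.+-identityˡ _ ⟩
  x (suc i)                                                    ∎

Iₘ-sym : (i j : Fin n) → Iₘ i j ≡ Iₘ j i
Iₘ-sym i j = cong (λ b → if b then 1ℤ else 0ℤ) (does-⇔ (mk⇔ sym sym) (i Fin.≟ j) (j Fin.≟ i))

sum-Iʳ : (i : Fin n) (x : Fin n → ℤ) → sumFin (λ j → x j * Iₘ j i) ≡ x i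
sum-Iʳ i x = trans (sum-cong (λ j → trans (ℤ.*-comm (x j) _) (cong (_* x j) (Iₘ-sym j i)))) (sum-Iˡ i x)

∣-sum : ∀ {p} {f : Fin n → ℤ} → (∀ i → p ∣ f i) → p ∣ sumFin f
∣-sum {zero}  h = divides 0ℤ refl
∣-sum {suc n} h = ∣m∣n⇒∣m+n (h zero) (∣-sum (h ∘ suc))

-- Rectangular matrices and the polynomials G

Rect : ℕ → ℕ → Set
Rect m n = Fin m → Fin n → ℤ

infixl 7 _∙_
_∙_ : Rect l m → Rect m n → Rect l n
(X ∙ Y) i j = sumFin (λ k → X i k * Y k j)

∙-assoc : (X : Rect l m) (Y : Rect m n) (Z : Rect n r) → ∀ i j → ((X ∙ Y) ∙ Z) i j ≡ (X ∙ (Y ∙ Z)) i j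
∙-assoc X Y Z i j = begin
  sumFin (λ k → sumFin (λ h → X i h * Y h k) * Z k j)    ≡⟨ sum-cong (λ k → sum-*ʳ (Z k j) (λ h → X i h * Y h k)) ⟨
  sumFin (λ k → sumFin (λ h → X i h * Y h k * Z k j))    ≡⟨ sum-swap (λ k h → X i h * Y h k * Z k j) ⟩
  sumFin (λ h → sumFin (λ k → X i h * Y h k * Z k j))    ≡⟨ sum-cong (λ h → sum-cong (λ k → ℤ.*-assoc (X i h) (Y h k) (Z k j))) ⟩
  sumFin (λ h → sumFin (λ k → X i h * (Y h k * Z k j)))  ≡⟨ sum-cong (λ h → sum-*ˡ (X i h) (λ k → Y h k * Z k j)) ⟩
  sumFin (λ h → X i h * sumFin (λ k → Y h k * Z k j))    ∎

∙-congˡ : (X : Rect l m) {Y Z : Rect m n} → (∀ i j → Y i j ≡ Z i j) → ∀ i j → (X ∙ Y) i j ≡ (X ∙ Z) i j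
∙-congˡ X eq i j = sum-cong (λ k → cong (X i k *_) (eq k j))

∙-congʳ : {X Y : Rect l m} (Z : Rect m n) → (∀ i j → X i j ≡ Y i j) → ∀ i j → (X ∙ Z) i j ≡ (Y ∙ Z) i j
∙-congʳ Z eq i j = sum-cong (λ k → cong (_* Z k j) (eq i k))

-- When `X` acts on the columns of `E` through `Y`, any polynomial in `X` acts through the same
-- polynomial in `Y`. One column gives an eigenvector, two columns the kernel of B, and taking all
-- three matrices equal to A gives commutation of G(A) with A.
module Intertwining (X : Mat m) (Y : Mat n) (E : Rect m n) (XE≡EY : ∀ i j → (X ∙ E) i j ≡ (E ∙ Y) i j) where

  ∙-intertwines : (P : Mat m) (Q : Mat n) → (∀ i j → (P ∙ E) i j ≡ (E ∙ Q) i j) →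
                  ∀ i j → ((X ⊗ P) ∙ E) i j ≡ (E ∙ (Y ⊗ Q)) i j
  ∙-intertwines P Q PE≡EQ i j = begin
    ((X ∙ P) ∙ E) i j  ≡⟨ ∙-assoc X P E i j ⟩
    (X ∙ (P ∙ E)) i j  ≡⟨ ∙-congˡ X PE≡EQ i j ⟩
    (X ∙ (E ∙ Q)) i j  ≡⟨ ∙-assoc X E Q i j ⟨
    ((X ∙ E) ∙ Q) i j  ≡⟨ ∙-congʳ Q XE≡EY i j ⟩
    ((E ∙ Y) ∙ Q) i j  ≡⟨ ∙-assoc E Y Q i j ⟩
    (E ∙ (Y ∙ Q)) i j  ∎

  Gpoly-intertwines : ∀ k i j → (Gpoly d k X ∙ E) i j ≡ (E ∙ Gpoly d k Y) i j
  Gpoly-intertwines zero i j = trans (sum-Iˡ i (λ k → E k j)) (sym (sum-Iʳ j (E i)))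
  Gpoly-intertwines (suc zero) i j = begin
    sumFin (λ k → (X i k + Iₘ i k) * E k j)      ≡⟨ sum-cong (λ k → ℤ.*-distribʳ-+ (E k j) (X i k) (Iₘ i k)) ⟩
    sumFin (λ k → X i k * E k j + Iₘ i k * E k j) ≡⟨ sum-+ _ (λ k → Iₘ i k * E k j) ⟩
    (X ∙ E) i j + (Iₘ ∙ E) i j                   ≡⟨ cong₂ _+_ (XE≡EY i j) (trans (sum-Iˡ i (λ k → E k j)) (sym (sum-Iʳ j (E i)))) ⟩
    (E ∙ Y) i j + (E ∙ Iₘ) i j                   ≡⟨ sum-+ _ (λ k → E i k * Iₘ k j) ⟨
    sumFin (λ k → E i k * Y k j + E i k * Iₘ k j) ≡⟨ sum-cong (λ k → ℤ.*-distribˡ-+ (E i k) (Y k j) (Iₘ k j)) ⟨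
    sumFin (λ k → E i k * (Y k j + Iₘ k j))      ∎
  Gpoly-intertwines {d} (suc (suc k)) i j = begin
    sumFin (λ h → (P i h - c * P′ i h) * E h j)               ≡⟨ sum-cong (λ h → distribʳ (P i h) c (P′ i h) (E h j)) ⟩
    sumFin (λ h → P i h * E h j - c * (P′ i h * E h j))       ≡⟨ sum-- _ (λ h → c * (P′ i h * E h j)) ⟩
    (P ∙ E) i j - sumFin (λ h → c * (P′ i h * E h j))         ≡⟨ cong (λ s → (P ∙ E) i j - s) (sum-*ˡ c (λ h → P′ i h * E h j)) ⟩
    (P ∙ E) i j - c * (P′ ∙ E) i j                            ≡⟨ cong₂ (λ s t → s - c * t)
                                                                         (∙-intertwines _ _ (Gpoly-intertwines (suc k)) i j)
                                                                         (Gpoly-intertwines k i j) ⟩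
    (E ∙ Q) i j - c * (E ∙ Q′) i j                            ≡⟨ cong (λ s → (E ∙ Q) i j - s) (sum-*ˡ c (λ h → E i h * Q′ h j)) ⟨
    (E ∙ Q) i j - sumFin (λ h → c * (E i h * Q′ h j))         ≡⟨ sum-- _ (λ h → c * (E i h * Q′ h j)) ⟨
    sumFin (λ h → E i h * Q h j - c * (E i h * Q′ h j))       ≡⟨ sum-cong (λ h → distribˡ (Q h j) c (Q′ h j) (E i h)) ⟨
    sumFin (λ h → E i h * (Q h j - c * Q′ h j))               ∎
    where
    c  = + (d ℕ.∸ 1)
    P  = X ⊗ Gpoly d (suc k) X
    P′ = Gpoly d k X
    Q  = Y ⊗ Gpoly d (suc k) Y
    Q′ = Gpoly d k Y
    distribʳ : ∀ a b x e → (a - b * x) * e ≡ a * e - b * (x * e)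
    distribʳ = solve-∀
    distribˡ : ∀ a b x e → e * (a - b * x) ≡ e * a - b * (e * x)
    distribˡ = solve-∀

open Intertwining using (Gpoly-intertwines)

-- The entries of `Gpoly d k X` are integer polynomials in those of `X`, so congruences pass
-- through. Products are compared by means of (a - b) x + b (x - y).
Gpoly-cong-mod : ∀ {p} {X Y : Mat r} → (∀ i j → p ∣ X i j - Y i j) →
                 ∀ k i j → p ∣ Gpoly d k X i j - Gpoly d k Y i j
Gpoly-cong-mod X≡Y zero i j = subst (_ ∣_) (sym (ℤ.+-inverseʳ (Iₘ i j))) (divides 0ℤ refl)
Gpoly-cong-mod {X = X} {Y} X≡Y (suc zero) i j =
  subst (_ ∣_) (lemma (X i j) (Y i j) (Iₘ i j)) (X≡Y i j)
  where
  lemma : ∀ a b c → a - b ≡ (a + c) - (b + c)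
  lemma = solve-∀
Gpoly-cong-mod {d = d} {p} {X} {Y} X≡Y (suc (suc k)) i j =
  subst (_ ∣_) (lemma ((X ⊗ P) i j) ((Y ⊗ Q) i j) c (P′ i j) (Q′ i j))
    (∣m∣n⇒∣m-n
      (subst (_ ∣_) (sum-- (λ h → X i h * P h j) (λ h → Y i h * Q h j))
        (∣-sum (λ h → subst (_ ∣_) (product (X i h) (Y i h) (P h j) (Q h j))
          (∣m∣n⇒∣m+n (∣m⇒∣m*n (P h j) (X≡Y i h)) (∣n⇒∣m*n (Y i h) (Gpoly-cong-mod X≡Y (suc k) h j))))))
      (∣n⇒∣m*n c (Gpoly-cong-mod X≡Y k i j)))
  where
  c  = + (d ℕ.∸ 1)
  P  = Gpoly d (suc k) X
  P′ = Gpoly d k X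
  Q  = Gpoly d (suc k) Y
  Q′ = Gpoly d k Y
  lemma : ∀ a b c x y → (a - b) - c * (x - y) ≡ (a - c * x) - (b - c * y)
  lemma = solve-∀
  product : ∀ a b x y → (a - b) * x + b * (x - y) ≡ a * x - b * y
  product = solve-∀

-- Zeros of G among 2×2 matrices

mat₂ : ℤ → ℤ → ℤ → ℤ → Mat 2
mat₂ a b c e zero    zero    = a
mat₂ a b c e zero    (suc _) = b
mat₂ a b c e (suc _) zero    = c
mat₂ a b c e (suc _) (suc _) = e

-- Quantifying over four residues instead of over a matrix lets `all?` decide the statement.
NoZeroMod : ℕ → ℕ → Set
NoZeroMod p k = ∀ (a b c e : Fin p) →
  ¬ (∀ i j → + p ∣ Gpoly 5 k (mat₂ (+ toℕ a) (+ toℕ b) (+ toℕ c) (+ toℕ e)) i j)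

noZeroMod? : ∀ p k → Dec (NoZeroMod p k)
noZeroMod? p k = all? λ a → all? λ b → all? λ c → all? λ e → ¬? (all? λ i → all? λ j → + p ∣? _)

NoZero₂ : ℕ → Set
NoZero₂ k = (M : Mat 2) → ¬ (∀ i j → Gpoly 5 k M i j ≡ 0ℤ)

-- An integral zero reduces entrywise to a zero modulo p, so searching the p^4 residue matrices is
-- enough.
noZeroMod⇒noZero₂ : ∀ p .{{_ : NonZero p}} k → NoZeroMod p k → NoZero₂ k
noZeroMod⇒noZero₂ p k none M GM≡0 = none (res zero zero) (res zero (suc zero)) (res (suc zero) zero) (res (suc zero) (suc zero)) divisible
  where
  res : Fin 2 → Fin 2 → Fin p
  res i j = fromℕ< (n%ℕd<d (M i j) p)
  N : Mat 2
  N = mat₂ (+ toℕ (res zero zero)) (+ toℕ (res zero (suc zero)))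
           (+ toℕ (res (suc zero) zero)) (+ toℕ (res (suc zero) (suc zero)))
  residue : ∀ i j → + p ∣ M i j - + toℕ (res i j)
  residue i j = divides (M i j /ℕ p) (begin
    M i j - + toℕ (res i j)                               ≡⟨ cong₂ (λ x y → x - + y) (a≡a%ℕn+[a/ℕn]*n (M i j) p) (toℕ-fromℕ< (n%ℕd<d (M i j) p)) ⟩
    (+ (M i j %ℕ p) + (M i j /ℕ p) * + p) - + (M i j %ℕ p) ≡⟨ lemma (+ (M i j %ℕ p)) _ ⟩
    (M i j /ℕ p) * + p                                    ∎)
    where
    lemma : ∀ a b → (a + b) - a ≡ b
    lemma = solve-∀
  M≡N : ∀ i j → + p ∣ M i j - N i j
  M≡N zero       zero       = residue zero zero
  M≡N zero       (suc zero) = residue zero (suc zero)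
  M≡N (suc zero) zero       = residue (suc zero) zero
  M≡N (suc zero) (suc zero) = residue (suc zero) (suc zero)
  divisible : ∀ i j → + p ∣ Gpoly 5 k N i j
  divisible i j = subst (_ ∣_) (lemma (Gpoly 5 k M i j) _ (GM≡0 i j))
                    (∣n⇒∣m*n -1ℤ (Gpoly-cong-mod M≡N k i j))
    where
    lemma : ∀ a b → a ≡ 0ℤ → -1ℤ * (a - b) ≡ b
    lemma a b refl = trans (ℤ.-1*i≡-i (0ℤ - b)) (lemma′ b)
      where
      lemma′ : ∀ b → - (0ℤ - b) ≡ b
      lemma′ = solve-∀

-- Over a prime field the minimal polynomial of a zero would be a factor of G of degree at most 2.
-- Modulo 3 this G is x³ + x² + x + 2, a cubic without roots. Here and in the next two cases the
-- search is evaluated, over 81 matrices modulo 3 and 625 modulo 5.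
noZero₂-3 : NoZero₂ 3
noZero₂-3 = noZeroMod⇒noZero₂ 3 3 (from-yes (noZeroMod? 3 3))

noZero₂-4 : NoZero₂ 4
noZero₂-4 = noZeroMod⇒noZero₂ 5 4 (from-yes (noZeroMod? 5 4))

noZero₂-7 : NoZero₂ 7
noZero₂-7 = noZeroMod⇒noZero₂ 5 7 (from-yes (noZeroMod? 5 7))

-- Values of G at integers

g : ℤ → ℕ → ℤ
g c zero          = 1ℤ
g c (suc zero)    = c + 1ℤ
g c (suc (suc k)) = c * g c (suc k) - + 4 * g c k

-- Translates one-column intertwining into eigenvalues: an eigenvalue c of A yields the eigenvalue
-- `g c k` of G(A).
Gpoly-1×1 : ∀ c k (i j : Fin 1) → Gpoly 5 k {1} (λ _ _ → c) i j ≡ g c k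
Gpoly-1×1 c zero          zero zero = refl
Gpoly-1×1 c (suc zero)    zero zero = refl
Gpoly-1×1 c (suc (suc k)) zero zero = cong₂ (λ x y → x - + 4 * y)
  (trans (ℤ.+-identityʳ _) (cong (c *_) (Gpoly-1×1 c (suc k) zero zero)))
  (Gpoly-1×1 c k zero zero)

-- Modulo 4 the recurrence reads g(k+1) ≡ 5 g(k) ≡ g(k), starting from 6 ≡ 2 at index 1.
g₅-mod4 : ∀ k → ∃[ q ] g (+ 5) (suc k) ≡ + 2 + q * + 4
g₅-mod4 zero = 1ℤ , refl
g₅-mod4 (suc k) = let q , eq = g₅-mod4 k in
  + 2 + + 5 * q - g (+ 5) k ,
  trans (cong (λ x → + 5 * x - + 4 * g (+ 5) k) eq) (lemma q (g (+ 5) k))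
  where
  lemma : ∀ q x → + 5 * (+ 2 + q * + 4) - + 4 * x ≡ + 2 + (+ 2 + + 5 * q - x) * + 4
  lemma = solve-∀

-- The indices m ≤ k < m + f with g c k = t, where a and b stand for g c m and g c (m + 1).
hits : ℤ → ℤ → ℕ → ℕ → ℤ → ℤ → List ℕ
hits c t zero    m a b = []
hits c t (suc f) m a b = if does (a ℤ.≟ t) then m ∷ rest else rest
  where rest = hits c t f (suc m) b (c * b - + 4 * a)

-- Induction on the offset j: the pair carried by `hits` advances to the values at m + 1 and m + 2,
-- so the tail has the same form with m raised and j lowered by one.
hits-complete : ∀ c t f m j → j < f → g c (j ℕ.+ m) ≡ t → j ℕ.+ m ∈ hits c t f m (g c m) (g c (suc m))
hits-complete c t (suc f) m zero    _         eq with g c m ℤ.≟ t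
... | yes _ = here refl
... | no ne = contradiction eq ne
hits-complete c t (suc f) m (suc j) (s≤s j<f) eq with g c m ℤ.≟ t | subst (λ k → g c k ≡ t → k ∈ hits c t f (suc m) (g c (suc m)) (g c (suc (suc m)))) (ℕ.+-suc j m) (hits-complete c t f (suc m) j j<f) eq
... | yes _ | k∈rest = there k∈rest
... | no _  | k∈rest = k∈rest

-- There are 19998 indices from 3 to 20000.
hitsUpTo20000 : ℤ → ℤ → List ℕ
hitsUpTo20000 c t = hits c t 19998 3 (g c 3) (g c 4)

hitsUpTo20000-complete : ∀ c t k → 3 ≤ k → k ≤ 20000 → g c k ≡ t → k ∈ hitsUpTo20000 c t
hitsUpTo20000-complete c t (suc (suc (suc j))) (s≤s (s≤s (s≤s _))) (s≤s (s≤s (s≤s j≤))) eq =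
  subst (_∈ hitsUpTo20000 c t) (ℕ.+-comm j 3)
    (hits-complete c t 19998 3 j (s≤s j≤) (subst (λ k → g c k ≡ t) (ℕ.+-comm 3 j) eq))

-- The cyclic successor

cycSucc-inject₁ : (q : Fin n) → cycSucc (inject₁ q) ≡ suc q
cycSucc-inject₁ {n} q with toℕ (inject₁ q) ℕ.<? n
... | yes lt = toℕ-injective (trans (toℕ-fromℕ< (s≤s lt)) (cong suc (toℕ-inject₁ q)))
... | no ≮n  = contradiction (subst (_< n) (sym (toℕ-inject₁ q)) (toℕ<n q)) ≮n

cycSucc-fromℕ : ∀ n → cycSucc (fromℕ n) ≡ zero
cycSucc-fromℕ n with toℕ (fromℕ n) ℕ.<? n
... | yes lt = contradiction (subst (_< n) (toℕ-fromℕ n) lt) (ℕ.<-irrefl refl)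
... | no _   = refl

cycSucc-injective : (p q : Fin n) → cycSucc p ≡ cycSucc q → p ≡ q
cycSucc-injective {suc n} p q eq with view p | view q
... | ‵fromℕ     | ‵fromℕ     = refl
... | ‵fromℕ     | ‵inject₁ j = contradiction (trans (sym (cycSucc-fromℕ n)) (trans eq (cycSucc-inject₁ j))) λ ()
... | ‵inject₁ i | ‵fromℕ     = contradiction (trans (sym (cycSucc-fromℕ n)) (trans (sym eq) (cycSucc-inject₁ i))) λ ()
... | ‵inject₁ i | ‵inject₁ j =
  cong inject₁ (suc-injective (trans (sym (cycSucc-inject₁ i)) (trans eq (cycSucc-inject₁ j))))

cycSucc-surjective : (p : Fin n) → ∃[ q ] cycSucc q ≡ p
cycSucc-surjective {suc n} zero    = fromℕ n , cycSucc-fromℕ n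
cycSucc-surjective {suc n} (suc p) = inject₁ p , cycSucc-inject₁ p

-- Keeps the two cycle neighbours of a vertex distinct, so that a row of the cycle matrix is the sum
-- of two different unit rows.
cycSucc²≢id : 3 ≤ n → (q : Fin n) → cycSucc (cycSucc q) ≢ q
cycSucc²≢id {suc (suc (suc n))} (s≤s (s≤s (s≤s _))) q eq with view q
... | ‵fromℕ = contradiction (trans (sym (cycSucc-inject₁ zero)) (trans (cong cycSucc (sym (cycSucc-fromℕ (suc (suc n))))) eq)) λ ()
... | ‵inject₁ i with view i
...   | ‵fromℕ     = contradiction (trans (sym (cycSucc-fromℕ (suc (suc n)))) (trans (cong cycSucc (sym (cycSucc-inject₁ (fromℕ (suc n))))) eq)) λ ()
...   | ‵inject₁ j = ℕ.m≢1+n+m (toℕ j) {1} (begin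
  toℕ j                                             ≡⟨ toℕ-inject₁ j ⟨
  toℕ (inject₁ j)                                   ≡⟨ toℕ-inject₁ (inject₁ j) ⟨
  toℕ (inject₁ (inject₁ j))                         ≡⟨ cong toℕ eq ⟨
  toℕ (cycSucc (cycSucc (inject₁ (inject₁ j))))     ≡⟨ cong (toℕ ∘ cycSucc) (cycSucc-inject₁ (inject₁ j)) ⟩
  toℕ (cycSucc (inject₁ (suc j)))                   ≡⟨ cong toℕ (cycSucc-inject₁ (suc j)) ⟩
  suc (suc (toℕ j))                                 ∎)

-- Every nonzero position is `cycSucc (inject₁ i)`, so induction on `Fin` walks along the cycle.
cycle-induction : (P : Fin (suc n) → Set) → P zero → (∀ q → P q → P (cycSucc q)) → ∀ q → P q
cycle-induction P P₀ P₊ = <-weakInduction P P₀ λ i Pi → subst P (cycSucc-inject₁ i) (P₊ (inject₁ i) Pi)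

-- The hypothesis σ n = σ 0 covers the one step that wraps around.
lift-cycSucc : (σ : ℕ → ℤ) → σ n ≡ σ 0 → (q : Fin n) → σ (toℕ (cycSucc q)) ≡ σ (suc (toℕ q))
lift-cycSucc {suc n} σ σn≡σ0 q with view q
... | ‵fromℕ     = trans (cong (σ ∘ toℕ) (cycSucc-fromℕ n)) (trans (sym σn≡σ0) (cong (σ ∘ suc) (sym (toℕ-fromℕ n))))
... | ‵inject₁ i = trans (cong (σ ∘ toℕ) (cycSucc-inject₁ i)) (cong (σ ∘ suc) (sym (toℕ-inject₁ i)))

-- Periodic sequences and recurrences around the cycle

sgn : ℕ → ℤ
sgn zero    = 1ℤ
sgn (suc p) = - sgn p

-- cosₚ p and sinₚ p are the real and imaginary parts of i ^ p.
cosₚ sinₚ : ℕ → ℤ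
cosₚ zero    = 1ℤ
cosₚ (suc p) = - sinₚ p
sinₚ zero    = 0ℤ
sinₚ (suc p) = cosₚ p

sgn-4∣ : ∀ r → sgn (r ℕ.* 4) ≡ 1ℤ
sgn-4∣ zero    = refl
sgn-4∣ (suc r) = cong (λ x → - - - - x) (sgn-4∣ r)

cosₚ-4∣ : ∀ r → cosₚ (r ℕ.* 4) ≡ 1ℤ
cosₚ-4∣ zero    = refl
cosₚ-4∣ (suc r) = cong (λ x → - - x) (cosₚ-4∣ r)

sinₚ-4∣ : ∀ r → sinₚ (r ℕ.* 4) ≡ 0ℤ
sinₚ-4∣ zero    = refl
sinₚ-4∣ (suc r) = cong (λ x → - - x) (sinₚ-4∣ r)

sgn-±1 : ∀ p → sgn p ≡ 1ℤ ⊎ sgn p ≡ -1ℤ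
sgn-±1 zero    = inj₁ refl
sgn-±1 (suc p) with sgn-±1 p
... | inj₁ eq = inj₂ (cong -_ eq)
... | inj₂ eq = inj₁ (cong -_ eq)

sgn² : ∀ p → sgn p * sgn p ≡ 1ℤ
sgn² p with sgn-±1 p
... | inj₁ eq = cong₂ _*_ eq eq
... | inj₂ eq = cong₂ _*_ eq eq

sgn-cycSucc : sgn n ≡ 1ℤ → (q : Fin n) → sgn (toℕ (cycSucc q)) ≡ - sgn (toℕ q)
sgn-cycSucc = lift-cycSucc sgn

-- For z(q) = (-1)^q y(q) the hypothesis says that the second difference of z vanishes, and κ is the
-- constant difference z(q) - z(q+1).
second-difference⇒slope : (y : Fin (suc n) → ℤ) → sgn (suc n) ≡ 1ℤ →
  (∀ q → y q + y (cycSucc (cycSucc q)) ≡ - + 2 * y (cycSucc q)) →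
  ∃[ κ ] (∀ q → y q + y (cycSucc q) ≡ sgn (toℕ q) * κ)
second-difference⇒slope y even rec = _ , cycle-induction
  (λ q → y q + y (cycSucc q) ≡ sgn (toℕ q) * (y zero + y (cycSucc zero)))
  (sym (ℤ.*-identityˡ _))
  (λ q → next (y q) (y (cycSucc q)) _ _ _ _ (rec q) (sgn-cycSucc even q))
  where
  next : ∀ a b c u v κ → a + c ≡ - + 2 * b → v ≡ - u → a + b ≡ u * κ → b + c ≡ v * κ
  next a b c u v κ eq refl ih = begin
    b + c                    ≡⟨ l₁ a b c ⟩
    b - a + (a + c)          ≡⟨ cong (λ s → b - a + s) eq ⟩
    b - a + - + 2 * b        ≡⟨ l₂ a b ⟩
    - (a + b)                ≡⟨ cong -_ ih ⟩
    - (u * κ)                ≡⟨ ℤ.neg-distribˡ-* u κ ⟩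
    - u * κ                  ∎
    where
    l₁ : ∀ a b c → b + c ≡ b - a + (a + c)
    l₁ = solve-∀
    l₂ : ∀ a b → b - a + - + 2 * b ≡ - (a + b)
    l₂ = solve-∀

slope⇒affine : (y : Fin (suc n) → ℤ) (κ : ℤ) → sgn (suc n) ≡ 1ℤ →
  (∀ q → y q + y (cycSucc q) ≡ sgn (toℕ q) * κ) →
  ∀ q → sgn (toℕ (cycSucc q)) * y (cycSucc q) ≡ sgn (toℕ q) * y q - κ
slope⇒affine y κ even slope q =
  next (y q) (y (cycSucc q)) _ _ κ (sgn-cycSucc even q) (sgn² (toℕ q)) (slope q)
  where
  next : ∀ a b u v κ → v ≡ - u → u * u ≡ 1ℤ → a + b ≡ u * κ → v * b ≡ u * a - κ
  next a b u v κ refl u² eq = begin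
    - u * b                   ≡⟨ l₁ u a b ⟩
    u * a - u * (a + b)       ≡⟨ cong (λ s → u * a - u * s) eq ⟩
    u * a - u * (u * κ)       ≡⟨ l₂ u a κ ⟩
    u * a - (u * u) * κ       ≡⟨ cong (λ s → u * a - s * κ) u² ⟩
    u * a - 1ℤ * κ            ≡⟨ cong (λ s → u * a - s) (ℤ.*-identityˡ κ) ⟩
    u * a - κ                 ∎
    where
    l₁ : ∀ a b c → - a * c ≡ a * b - a * (b + c)
    l₁ = solve-∀
    l₂ : ∀ u a k → u * a - u * (u * k) ≡ u * a - (u * u) * k
    l₂ = solve-∀

-- A full turn subtracts (n + 1) κ from z and returns to the start, which forces κ = 0.
affine⇒constant : (z : Fin (suc n) → ℤ) (κ : ℤ) → (∀ q → z (cycSucc q) ≡ z q - κ) → ∀ q → z q ≡ z zero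
affine⇒constant {n} z κ drop = cycle-induction (λ q → z q ≡ z zero) refl λ q ih →
  trans (drop q) (trans (cong (λ s → z q - s) κ≡0) (trans (ℤ.+-identityʳ (z q)) ih))
  where
  affine : ∀ q → z q ≡ z zero - + toℕ q * κ
  affine = <-weakInduction (λ q → z q ≡ z zero - + toℕ q * κ) (l₀ (z zero) κ) λ i ih → begin
    z (suc i)                              ≡⟨ cong z (cycSucc-inject₁ i) ⟨
    z (cycSucc (inject₁ i))                ≡⟨ drop (inject₁ i) ⟩
    z (inject₁ i) - κ                      ≡⟨ cong (_- κ) ih ⟩
    z zero - + toℕ (inject₁ i) * κ - κ     ≡⟨ cong (λ p → z zero - + p * κ - κ) (toℕ-inject₁ i) ⟩
    z zero - + toℕ i * κ - κ               ≡⟨ l₁ (z zero) (+ toℕ i) κ ⟩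
    z zero - (1ℤ + + toℕ i) * κ            ∎
    where
    l₀ : ∀ a b → a ≡ a - 0ℤ * b
    l₀ = solve-∀
    l₁ : ∀ a p k → a - p * k - k ≡ a - (1ℤ + p) * k
    l₁ = solve-∀
  around : z zero ≡ z zero - + n * κ - κ
  around = begin
    z zero                                 ≡⟨ cong z (cycSucc-fromℕ n) ⟨
    z (cycSucc (fromℕ n))                  ≡⟨ drop (fromℕ n) ⟩
    z (fromℕ n) - κ                        ≡⟨ cong (_- κ) (affine (fromℕ n)) ⟩
    z zero - + toℕ (fromℕ n) * κ - κ       ≡⟨ cong (λ p → z zero - + p * κ - κ) (toℕ-fromℕ n) ⟩
    z zero - + n * κ - κ                   ∎
  nκ≡0 : ∀ a p k → a ≡ a - p * k - k → (1ℤ + p) * k ≡ 0ℤ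
  nκ≡0 a p k eq = trans (l₂ a p k) (trans (cong (_- (a - p * k - k)) eq) (ℤ.+-inverseʳ (a - p * k - k)))
    where
    l₂ : ∀ a p k → (1ℤ + p) * k ≡ a - (a - p * k - k)
    l₂ = solve-∀
  κ≡0 : κ ≡ 0ℤ
  κ≡0 with ℤ.i*j≡0⇒i≡0∨j≡0 (+ suc n) {κ} (nκ≡0 (z zero) (+ n) κ around)
  ... | inj₂ eq = eq

-- (-1)^q y q is affine along the cycle, and going around once makes it constant.
alternating : (y : Fin (suc n) → ℤ) → sgn (suc n) ≡ 1ℤ →
              (∀ q → y q + y (cycSucc (cycSucc q)) ≡ - + 2 * y (cycSucc q)) →
              ∀ q → y q ≡ sgn (toℕ q) * y zero
alternating y even rec q = let κ , slope = second-difference⇒slope y even rec in begin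
  y q                                     ≡⟨ ℤ.*-identityˡ (y q) ⟨
  1ℤ * y q                                ≡⟨ cong (_* y q) (sgn² (toℕ q)) ⟨
  sgn (toℕ q) * sgn (toℕ q) * y q         ≡⟨ ℤ.*-assoc (sgn (toℕ q)) (sgn (toℕ q)) (y q) ⟩
  sgn (toℕ q) * (sgn (toℕ q) * y q)       ≡⟨ cong (sgn (toℕ q) *_) (affine⇒constant (λ p → sgn (toℕ p) * y p) κ (slope⇒affine y κ even slope) q) ⟩
  sgn (toℕ q) * (1ℤ * y zero)             ≡⟨ cong (sgn (toℕ q) *_) (ℤ.*-identityˡ (y zero)) ⟩
  sgn (toℕ q) * y zero                    ∎

-- Two steps multiply by i² = -1; the hypotheses say i^n = 1, so this holds across the wrap too.
cosₚ-shift : cosₚ n ≡ 1ℤ → sinₚ n ≡ 0ℤ → (q : Fin n) → cosₚ (toℕ (cycSucc (cycSucc q))) ≡ - cosₚ (toℕ q)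
cosₚ-shift cos≡1 sin≡0 q = trans (lift-cycSucc cosₚ cos≡1 (cycSucc q)) (cong -_ (lift-cycSucc sinₚ sin≡0 q))

sinₚ-shift : cosₚ n ≡ 1ℤ → sinₚ n ≡ 0ℤ → (q : Fin n) → sinₚ (toℕ (cycSucc (cycSucc q))) ≡ - sinₚ (toℕ q)
sinₚ-shift cos≡1 sin≡0 q = trans (lift-cycSucc sinₚ sin≡0 (cycSucc q)) (lift-cycSucc cosₚ cos≡1 q)

-- The recurrence y(q+2) = -y(q) has order two, and `cosₚ`, `sinₚ` are its solutions with initial
-- values (1, 0) and (0, 1). The induction therefore carries two consecutive positions.
quarter-turn : (y : Fin (suc n) → ℤ) → cosₚ (suc n) ≡ 1ℤ → sinₚ (suc n) ≡ 0ℤ →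
               (∀ q → y q + y (cycSucc (cycSucc q)) ≡ 0ℤ) →
               ∀ q → y q ≡ cosₚ (toℕ q) * y zero + sinₚ (toℕ q) * y (cycSucc zero)
quarter-turn {n} y cos≡1 sin≡0 rec = proj₁ ∘ cycle-induction (λ q → y q ≡ F q × y (cycSucc q) ≡ F (cycSucc q))
  (base₀ (y zero) (y (cycSucc zero)) ,
   base₁ _ _ (y zero) (y (cycSucc zero)) (lift-cycSucc {suc n} cosₚ cos≡1 zero) (lift-cycSucc {suc n} sinₚ sin≡0 zero))
  λ q (ih , ih′) → ih′ ,
    next (y q) (y (cycSucc (cycSucc q))) (cosₚ (toℕ q)) (sinₚ (toℕ q)) _ _ (y zero) (y (cycSucc zero))
      (rec q) (cosₚ-shift {suc n} cos≡1 sin≡0 q) (sinₚ-shift {suc n} cos≡1 sin≡0 q) ih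
  where
  F : Fin (suc n) → ℤ
  F q = cosₚ (toℕ q) * y zero + sinₚ (toℕ q) * y (cycSucc zero)
  base₀ : ∀ a b → a ≡ 1ℤ * a + 0ℤ * b
  base₀ = solve-∀
  base₁ : ∀ c s a b → c ≡ 0ℤ → s ≡ 1ℤ → b ≡ c * a + s * b
  base₁ _ _ a b refl refl = lemma a b
    where
    lemma : ∀ a b → b ≡ 0ℤ * a + 1ℤ * b
    lemma = solve-∀
  next : ∀ a b c s c′ s′ x z → a + b ≡ 0ℤ → c′ ≡ - c → s′ ≡ - s → a ≡ c * x + s * z → b ≡ c′ * x + s′ * z
  next a b c s _ _ x z a+b≡0 refl refl eq = begin
    b                       ≡⟨ l₁ a b ⟩
    a + b - a               ≡⟨ cong₂ _-_ a+b≡0 eq ⟩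
    0ℤ - (c * x + s * z)    ≡⟨ l₂ c x s z ⟩
    - c * x + - s * z       ∎
    where
    l₁ : ∀ a b → b ≡ a + b - a
    l₁ = solve-∀
    l₂ : ∀ c x s z → 0ℤ - (c * x + s * z) ≡ - c * x + - s * z
    l₂ = solve-∀

-- The action of the cycle matrix

module _ (3≤n : 3 ≤ n) (π : Permutation′ n) where

  -- The row is indexed by the middle of three consecutive vertices, so that no cyclic predecessor is needed.
  cycleMat-row : ∀ q j → cycleMat π (π ⟨$⟩ʳ cycSucc q) j ≡ Iₘ (π ⟨$⟩ʳ q) j + Iₘ (π ⟨$⟩ʳ cycSucc (cycSucc q)) j
  cycleMat-row q j = begin
    ind (does (cycSucc (π ⟨$⟩ˡ (π ⟨$⟩ʳ cycSucc q)) Fin.≟ (π ⟨$⟩ˡ j)) ∨ does (cycSucc (π ⟨$⟩ˡ j) Fin.≟ (π ⟨$⟩ˡ (π ⟨$⟩ʳ cycSucc q))))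
      ≡⟨ cong₂ (λ a b → ind (a ∨ b))
           (does-⇔ (mk⇔ (λ eq → trans (cong (π ⟨$⟩ʳ_) (trans (cong cycSucc (sym (inverseˡ π))) eq)) (inverseʳ π))
                        (λ { refl → trans (cong cycSucc (inverseˡ π)) (sym (inverseˡ π)) }))
                   (_ Fin.≟ _) ((π ⟨$⟩ʳ cycSucc (cycSucc q)) Fin.≟ j))
           (does-⇔ (mk⇔ (λ eq → trans (cong (π ⟨$⟩ʳ_) (cycSucc-injective q (π ⟨$⟩ˡ j) (trans (sym (inverseˡ π)) (sym eq)))) (inverseʳ π))
                        (λ { refl → trans (cong cycSucc (inverseˡ π)) (sym (inverseˡ π)) }))
                   (_ Fin.≟ _) ((π ⟨$⟩ʳ q) Fin.≟ j)) ⟩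
    ind (does ((π ⟨$⟩ʳ cycSucc (cycSucc q)) Fin.≟ j) ∨ does ((π ⟨$⟩ʳ q) Fin.≟ j))
      ≡⟨ disjoint ⟩
    Iₘ (π ⟨$⟩ʳ q) j + Iₘ (π ⟨$⟩ʳ cycSucc (cycSucc q)) j
      ∎
    where
    ind : Bool → ℤ
    ind b = if b then 1ℤ else 0ℤ
    disjoint : ind (does ((π ⟨$⟩ʳ cycSucc (cycSucc q)) Fin.≟ j) ∨ does ((π ⟨$⟩ʳ q) Fin.≟ j)) ≡ Iₘ (π ⟨$⟩ʳ q) j + Iₘ (π ⟨$⟩ʳ cycSucc (cycSucc q)) j
    disjoint with (π ⟨$⟩ʳ cycSucc (cycSucc q)) Fin.≟ j | (π ⟨$⟩ʳ q) Fin.≟ j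
    ... | yes e | yes e′ = contradiction (trans (sym (inverseˡ π)) (trans (cong (π ⟨$⟩ˡ_) (trans e (sym e′))) (inverseˡ π))) (cycSucc²≢id 3≤n q)
    ... | yes _ | no _   = refl
    ... | no _  | yes _  = refl
    ... | no _  | no _   = refl

  -- Turns equations in B into second-order recurrences along the cycle, as treated by `alternating`
  -- and `quarter-turn`.
  cycleMat-∙ : (E : Rect n r) → ∀ q t → (cycleMat π ∙ E) (π ⟨$⟩ʳ cycSucc q) t ≡ E (π ⟨$⟩ʳ q) t + E (π ⟨$⟩ʳ cycSucc (cycSucc q)) t
  cycleMat-∙ E q t = begin
    sumFin (λ j → cycleMat π (π ⟨$⟩ʳ cycSucc q) j * E j t)
      ≡⟨ sum-cong (λ j → trans (cong (_* E j t) (cycleMat-row q j)) (ℤ.*-distribʳ-+ (E j t) (Iₘ (π ⟨$⟩ʳ q) j) (Iₘ (π ⟨$⟩ʳ cycSucc (cycSucc q)) j))) ⟩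
    sumFin (λ j → Iₘ (π ⟨$⟩ʳ q) j * E j t + Iₘ (π ⟨$⟩ʳ cycSucc (cycSucc q)) j * E j t)
      ≡⟨ sum-+ (λ j → Iₘ (π ⟨$⟩ʳ q) j * E j t) (λ j → Iₘ (π ⟨$⟩ʳ cycSucc (cycSucc q)) j * E j t) ⟩
    sumFin (λ j → Iₘ (π ⟨$⟩ʳ q) j * E j t) + sumFin (λ j → Iₘ (π ⟨$⟩ʳ cycSucc (cycSucc q)) j * E j t)
      ≡⟨ cong₂ _+_ (sum-Iˡ _ (λ j → E j t)) (sum-Iˡ _ (λ j → E j t)) ⟩
    E (π ⟨$⟩ʳ q) t + E (π ⟨$⟩ʳ cycSucc (cycSucc q)) t ∎

-- The matrix equation

twice-zero : ∀ x → x ≡ - x → x ≡ 0ℤ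
twice-zero x eq with ℤ.i*j≡0⇒i≡0∨j≡0 (+ 2) {x} (begin
  + 2 * x  ≡⟨ double x ⟩
  x + x    ≡⟨ cong (_+ x) eq ⟩
  - x + x  ≡⟨ ℤ.+-inverseˡ x ⟩
  0ℤ       ∎)
  where
  double : ∀ x → + 2 * x ≡ x + x
  double = solve-∀
... | inj₂ x≡0 = x≡0

-- The witnesses count the neighbours of sign 1 and of sign -1.
±1-sum : (a : Fin n → Bool) (u : Fin n → ℤ) → (∀ j → u j ≡ 1ℤ ⊎ u j ≡ -1ℤ) →
  ∃₂ λ x y → sumFin (λ j → if a j then 1ℤ else 0ℤ) ≡ + (x ℕ.+ y)
           × sumFin (λ j → (if a j then 1ℤ else 0ℤ) * u j) ≡ + x - + y
±1-sum {zero}  a u u±1 = 0 , 0 , refl , refl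
±1-sum {suc n} a u u±1 with ±1-sum (a ∘ suc) (u ∘ suc) (u±1 ∘ suc) | a zero | u zero | u±1 zero
... | x , y , eq , eq′ | false | v | _         = x , y , trans (ℤ.+-identityˡ _) eq ,
  trans (cong₂ _+_ (ℤ.*-zeroˡ v) eq′) (ℤ.+-identityˡ (+ x - + y))
... | x , y , eq , eq′ | true  | _ | inj₁ refl = suc x , y , cong (λ s → 1ℤ + s) eq ,
  trans (cong (λ s → 1ℤ + s) eq′) (sym (ℤ.+-assoc 1ℤ (+ x) (- + y)))
... | x , y , eq , eq′ | true  | _ | inj₂ refl = x , suc y ,
  trans (cong (λ s → 1ℤ + s) eq) (cong +_ (sym (ℕ.+-suc x y))) ,
  trans (cong (λ s → -1ℤ + s) eq′) (lemma (+ x) (+ y))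
  where
  lemma : ∀ a b → -1ℤ + (a - b) ≡ a - (1ℤ + b)
  lemma = solve-∀

±1-cancel : ∀ e → e ≡ 1ℤ ⊎ e ≡ -1ℤ → ∀ x y → e * x ≡ e * y → x ≡ y
±1-cancel _ (inj₁ refl) x y = ℤ.*-cancelˡ-≡ 1ℤ x y
±1-cancel _ (inj₂ refl) x y = ℤ.*-cancelˡ-≡ -1ℤ x y

-- Both signs lead to the same conclusion because 2 ≡ -2 modulo 4.
2mod4-±2 : ∀ m q e → e ≡ 1ℤ ⊎ e ≡ -1ℤ → + 2 + q * + 4 ≡ + m + e * + 2 → ∃[ r ] m ≡ r ℕ.* 4
2mod4-±2 m q e e±1 eq = case ∣⇒∣ᵤ (divisible e e±1 eq) of λ { (ℕ.divides r m≡r*4) → r , m≡r*4 }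
  where
  solve-for : ∀ a b c → a ≡ b + c → b ≡ a - c
  solve-for _ b c refl = lemma b c
    where
    lemma : ∀ b c → b ≡ b + c - c
    lemma = solve-∀
  divisible : ∀ e → e ≡ 1ℤ ⊎ e ≡ -1ℤ → + 2 + q * + 4 ≡ + m + e * + 2 → + 4 ∣ + m
  divisible _ (inj₁ refl) eq = divides q (trans (solve-for _ (+ m) (+ 2) eq) (lemma q))
    where
    lemma : ∀ q → + 2 + q * + 4 - + 2 ≡ q * + 4
    lemma = solve-∀
  divisible _ (inj₂ refl) eq = divides (1ℤ + q) (trans (solve-for _ (+ m) (- + 2) eq) (lemma q))
    where
    lemma : ∀ q → + 2 + q * + 4 - - + 2 ≡ (1ℤ + q) * + 4
    lemma = solve-∀

-- Treats both problems at once, with ε = 1 for the defect and ε = -1 for the excess. The index is a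
-- successor because `g₅-mod4` starts at index 1.
module CyclicEquation {n : ℕ} (Γ : Graph (suc n)) (regular : Regular 5 Γ)
  (3≤n : 3 ≤ suc n) (π : Permutation′ (suc n)) (k : ℕ) (ε : ℤ) (ε±1 : ε ≡ 1ℤ ⊎ ε ≡ -1ℤ)
  (equation : ∀ i j → Gpoly 5 (suc k) (adjMat Γ) i j ≡ 1ℤ + ε * cycleMat π i j) where

  private
    N = suc n
    A B : Mat N
    A = adjMat Γ
    B = cycleMat π

  column-sum : ∀ j → sumFin (λ i → A i j) ≡ + 5
  column-sum j = trans (sum-cong (λ i → cong (λ b → if b then 1ℤ else 0ℤ) (adj-sym Γ i j))) (regular j)

  -- Matches the form of `cycleMat-∙`, whose rows sit at successors; `cycSucc` reaches every
  -- position.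
  on-cycle : (P : Fin N → Set) → (∀ q → P (π ⟨$⟩ʳ cycSucc q)) → ∀ i → P i
  on-cycle P h i = let q , eq = cycSucc-surjective (π ⟨$⟩ˡ i) in
    subst P (trans (cong (π ⟨$⟩ʳ_) eq) (inverseʳ π)) (h q)

  G-∙ : ∀ {r} (E : Rect N r) i t → (Gpoly 5 (suc k) A ∙ E) i t ≡ sumFin (λ j → E j t) + ε * (B ∙ E) i t
  G-∙ E i t = begin
    sumFin (λ j → Gpoly 5 (suc k) A i j * E j t)               ≡⟨ sum-cong (λ j → trans (cong (_* E j t) (equation i j)) (expand ε (B i j) (E j t))) ⟩
    sumFin (λ j → E j t + ε * (B i j * E j t))                 ≡⟨ sum-+ (λ j → E j t) (λ j → ε * (B i j * E j t)) ⟩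
    sumFin (λ j → E j t) + sumFin (λ j → ε * (B i j * E j t))  ≡⟨ cong (λ s → sumFin (λ j → E j t) + s) (sum-*ˡ ε (λ j → B i j * E j t)) ⟩
    sumFin (λ j → E j t) + ε * (B ∙ E) i t                     ∎
    where
    expand : ∀ e b x → (1ℤ + e * b) * x ≡ x + e * (b * x)
    expand = solve-∀

  -- A commutes with G(A), and regularity with symmetry gives AJ = JA = 5J; cancelling 5 and then ε
  -- leaves B.
  AB≡BA : ∀ i j → (A ∙ B) i j ≡ (B ∙ A) i j
  AB≡BA i j = ±1-cancel ε ε±1 _ _ (∙-cancelˡ (+ 5) _ _ (begin
    + 5 + ε * (A ∙ B) i j                                  ≡⟨ cong₂ _+_ (sym (regular i)) (sym (sum-*ˡ ε (λ h → A i h * B h j))) ⟩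
    sumFin (A i) + sumFin (λ h → ε * (A i h * B h j))      ≡⟨ sum-+ (A i) (λ h → ε * (A i h * B h j)) ⟨
    sumFin (λ h → A i h + ε * (A i h * B h j))             ≡⟨ sum-cong (λ h → trans (cong (A i h *_) (equation h j)) (expand ε (B h j) (A i h))) ⟨
    (A ∙ Gpoly 5 (suc k) A) i j                            ≡⟨ Gpoly-intertwines A A A (λ _ _ → refl) (suc k) i j ⟨
    (Gpoly 5 (suc k) A ∙ A) i j                            ≡⟨ G-∙ A i j ⟩
    sumFin (λ h → A h j) + ε * (B ∙ A) i j                 ≡⟨ cong (_+ ε * (B ∙ A) i j) (column-sum j) ⟩
    + 5 + ε * (B ∙ A) i j                                  ∎))
    where
    expand : ∀ e b x → x * (1ℤ + e * b) ≡ x + e * (x * b)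
    expand = solve-∀

  BAE≡ABE : ∀ {r} (E : Rect N r) i t → (B ∙ (A ∙ E)) i t ≡ (A ∙ (B ∙ E)) i t
  BAE≡ABE E i t = begin
    (B ∙ (A ∙ E)) i t  ≡⟨ ∙-assoc B A E i t ⟨
    ((B ∙ A) ∙ E) i t  ≡⟨ ∙-congʳ E AB≡BA i t ⟨
    ((A ∙ B) ∙ E) i t  ≡⟨ ∙-assoc A B E i t ⟩
    (A ∙ (B ∙ E)) i t  ∎

  -- Both sides of the matrix equation are applied to the all-ones vector, an eigenvector of A for 5
  -- and of B for 2.
  order : g (+ 5) (suc k) ≡ + N + ε * + 2
  order = begin
    g (+ 5) (suc k)                                  ≡⟨ Gpoly-1×1 (+ 5) (suc k) zero zero ⟨
    Gpoly 5 (suc k) {1} (λ _ _ → + 5) zero zero      ≡⟨ trans (ℤ.+-identityʳ _) (ℤ.*-identityˡ _) ⟨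
    (ones ∙ Gpoly 5 (suc k) {1} (λ _ _ → + 5)) v zero ≡⟨ Gpoly-intertwines A (λ _ _ → + 5) ones A1≡5 (suc k) v zero ⟨
    (Gpoly 5 (suc k) A ∙ ones) v zero                ≡⟨ G-∙ ones v zero ⟩
    sumFin {N} (λ _ → 1ℤ) + ε * (B ∙ ones) v zero    ≡⟨ cong₂ (λ s t → s + ε * t) (sum-one N) (cycleMat-∙ 3≤n π ones zero zero) ⟩
    + N + ε * + 2                                    ∎
    where
    v = π ⟨$⟩ʳ cycSucc zero
    ones : Rect N 1
    ones _ _ = 1ℤ
    A1≡5 : ∀ i j → (A ∙ ones) i j ≡ (ones ∙ (λ (_ _ : Fin 1) → + 5)) i j
    A1≡5 i j = trans (sum-cong (λ h → ℤ.*-identityʳ (A i h))) (regular i)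

  -- Makes (-1)^q and i^q well defined around the cycle.
  4∣N : ∃[ r ] N ≡ r ℕ.* 4
  4∣N = let q , eq = g₅-mod4 k in 2mod4-±2 N q ε ε±1 (trans (sym eq) order)

  sgn-N : sgn N ≡ 1ℤ
  sgn-N = let r , eq = 4∣N in trans (cong sgn eq) (sgn-4∣ r)

  cosₚ-N : cosₚ N ≡ 1ℤ
  cosₚ-N = let r , eq = 4∣N in trans (cong cosₚ eq) (cosₚ-4∣ r)

  sinₚ-N : sinₚ N ≡ 0ℤ
  sinₚ-N = let r , eq = 4∣N in trans (cong sinₚ eq) (sinₚ-4∣ r)

  -- The alternating eigenvector of B and its eigenvalue under A

  U : Rect N 1
  U i _ = sgn (toℕ (π ⟨$⟩ˡ i))

  U-π : ∀ q t → U (π ⟨$⟩ʳ q) t ≡ sgn (toℕ q)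
  U-π q t = cong (sgn ∘ toℕ) (inverseˡ π)

  BU≡-2U : ∀ i t → (B ∙ U) i t ≡ - + 2 * U i t
  BU≡-2U = on-cycle _ λ q t → begin
    (B ∙ U) (π ⟨$⟩ʳ cycSucc q) t                           ≡⟨ cycleMat-∙ 3≤n π U q t ⟩
    U (π ⟨$⟩ʳ q) t + U (π ⟨$⟩ʳ cycSucc (cycSucc q)) t      ≡⟨ cong₂ _+_ (U-π q t) (U-π (cycSucc (cycSucc q)) t) ⟩
    sgn (toℕ q) + sgn (toℕ (cycSucc (cycSucc q)))          ≡⟨ lemma _ _ _ (sgn-cycSucc sgn-N q) (sgn-cycSucc sgn-N (cycSucc q)) ⟩
    - + 2 * sgn (toℕ (cycSucc q))                          ≡⟨ cong (- + 2 *_) (U-π (cycSucc q) t) ⟨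
    - + 2 * U (π ⟨$⟩ʳ cycSucc q) t                         ∎
    where
    lemma : ∀ a b c → b ≡ - a → c ≡ - b → a + c ≡ - + 2 * b
    lemma a _ _ refl refl = l₁ a
      where
      l₁ : ∀ a → a + - - a ≡ - + 2 * - a
      l₁ = solve-∀

  -- Read off at position 0, where `U` has the value 1.
  θ : ℤ
  θ = (A ∙ U) (π ⟨$⟩ʳ zero) zero

  -- Since A commutes with B, AU is again in the eigenspace of B for -2, which `alternating` shows
  -- to be spanned by `U`.
  AU-alternates : ∀ q → (A ∙ U) (π ⟨$⟩ʳ q) zero ≡ sgn (toℕ q) * θ
  AU-alternates = alternating (λ q → (A ∙ U) (π ⟨$⟩ʳ q) zero) sgn-N λ q → begin
    (A ∙ U) (π ⟨$⟩ʳ q) zero + (A ∙ U) (π ⟨$⟩ʳ cycSucc (cycSucc q)) zero  ≡⟨ cycleMat-∙ 3≤n π (A ∙ U) q zero ⟨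
    (B ∙ (A ∙ U)) (π ⟨$⟩ʳ cycSucc q) zero                                ≡⟨ BAE≡ABE U _ zero ⟩
    (A ∙ (B ∙ U)) (π ⟨$⟩ʳ cycSucc q) zero                                ≡⟨ sum-cong (λ j → trans (cong (A (π ⟨$⟩ʳ cycSucc q) j *_) (BU≡-2U j zero)) (lemma (A (π ⟨$⟩ʳ cycSucc q) j) (U j zero))) ⟩
    sumFin (λ j → - + 2 * (A (π ⟨$⟩ʳ cycSucc q) j * U j zero))           ≡⟨ sum-*ˡ (- + 2) (λ j → A (π ⟨$⟩ʳ cycSucc q) j * U j zero) ⟩
    - + 2 * (A ∙ U) (π ⟨$⟩ʳ cycSucc q) zero                              ∎
    where
    lemma : ∀ a u → a * (- + 2 * u) ≡ - + 2 * (a * u)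
    lemma = solve-∀

  AU≡Uθ : ∀ i t → (A ∙ U) i t ≡ (U ∙ (λ (_ _ : Fin 1) → θ)) i t
  AU≡Uθ = on-cycle _ λ { q zero → trans (AU-alternates (cycSucc q))
    (sym (trans (ℤ.+-identityʳ _) (cong (_* θ) (U-π (cycSucc q) zero)))) }

  G-θ : ∀ q → sgn (toℕ q) * g θ (suc k) ≡ sumFin (λ j → U j zero) + ε * (- + 2 * sgn (toℕ q))
  G-θ q = begin
    sgn (toℕ q) * g θ (suc k)                                    ≡⟨ cong₂ _*_ (U-π q zero) (Gpoly-1×1 θ (suc k) zero zero) ⟨
    U (π ⟨$⟩ʳ q) zero * Gpoly 5 (suc k) {1} (λ _ _ → θ) zero zero ≡⟨ ℤ.+-identityʳ _ ⟨
    (U ∙ Gpoly 5 (suc k) {1} (λ _ _ → θ)) (π ⟨$⟩ʳ q) zero        ≡⟨ Gpoly-intertwines A (λ _ _ → θ) U AU≡Uθ (suc k) _ zero ⟨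
    (Gpoly 5 (suc k) A ∙ U) (π ⟨$⟩ʳ q) zero                      ≡⟨ G-∙ U _ zero ⟩
    sumFin (λ j → U j zero) + ε * (B ∙ U) (π ⟨$⟩ʳ q) zero        ≡⟨ cong (λ s → sumFin (λ j → U j zero) + ε * s) (trans (BU≡-2U _ zero) (cong (- + 2 *_) (U-π q zero))) ⟩
    sumFin (λ j → U j zero) + ε * (- + 2 * sgn (toℕ q))          ∎

  -- Positions 0 and 1 carry opposite signs but the same sum of `U`. Comparing them eliminates that
  -- sum.
  g-θ : g θ (suc k) ≡ ε * - + 2
  g-θ = solution (g θ (suc k)) (sumFin (λ j → U j zero)) ε (G-θ zero)
          (subst (λ s → s * g θ (suc k) ≡ sumFin (λ j → U j zero) + ε * (- + 2 * s)) (sgn-cycSucc {N} sgn-N zero) (G-θ (cycSucc zero)))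
    where
    solution : ∀ x s e → 1ℤ * x ≡ s + e * (- + 2 * 1ℤ) → - 1ℤ * x ≡ s + e * (- + 2 * - 1ℤ) → x ≡ e * - + 2
    solution x s e eq eq′ = trans (l₁ x e) (trans (cong (_+ e * - + 2) (twice-zero (x - e * - + 2) (begin
      x - e * - + 2                            ≡⟨ l₂ x e ⟩
      1ℤ * x - e * - + 2                       ≡⟨ cong (_- e * - + 2) eq ⟩
      s + e * (- + 2 * 1ℤ) - e * - + 2         ≡⟨ l₃ s e ⟩
      s + e * (- + 2 * - 1ℤ) + e * - + 2       ≡⟨ cong (_+ e * - + 2) eq′ ⟨
      - 1ℤ * x + e * - + 2                     ≡⟨ l₄ x e ⟩
      - (x - e * - + 2)                        ∎))) (ℤ.+-identityˡ _))
      where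
      l₁ : ∀ x e → x ≡ x - e * - + 2 + e * - + 2
      l₁ = solve-∀
      l₂ : ∀ x e → x - e * - + 2 ≡ 1ℤ * x - e * - + 2
      l₂ = solve-∀
      l₃ : ∀ s e → s + e * (- + 2 * 1ℤ) - e * - + 2 ≡ s + e * (- + 2 * - 1ℤ) + e * - + 2
      l₃ = solve-∀
      l₄ : ∀ x e → - 1ℤ * x + e * - + 2 ≡ - (x - e * - + 2)
      l₄ = solve-∀

  -- θ adds up the signs of the five neighbours of the vertex at position 0, which leaves six
  -- candidates x - y.
  eigenvalue : ∃₂ λ x y → x ℕ.+ y ≡ 5 × g (+ x - + y) (suc k) ≡ ε * - + 2
  eigenvalue = let x , y , degree≡ , θ≡ = ±1-sum (adj Γ v) (λ j → U j zero) (λ j → sgn-±1 (toℕ (π ⟨$⟩ˡ j))) in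
    x , y , ℤ.+-injective (trans (sym degree≡) (regular v)) , trans (cong (λ c → g c (suc k)) (sym θ≡)) g-θ
    where
    v = π ⟨$⟩ʳ zero

  -- The kernel of B, spanned by the real and imaginary parts of i^q

  C : Rect N 2
  C i zero    = cosₚ (toℕ (π ⟨$⟩ˡ i))
  C i (suc _) = sinₚ (toℕ (π ⟨$⟩ˡ i))

  C-π-shift : ∀ q t → C (π ⟨$⟩ʳ cycSucc (cycSucc q)) t ≡ - C (π ⟨$⟩ʳ q) t
  C-π-shift q zero    = trans (cong (cosₚ ∘ toℕ) (inverseˡ π)) (trans (cosₚ-shift cosₚ-N sinₚ-N q) (cong (-_ ∘ cosₚ ∘ toℕ) (sym (inverseˡ π))))
  C-π-shift q (suc _) = trans (cong (sinₚ ∘ toℕ) (inverseˡ π)) (trans (sinₚ-shift cosₚ-N sinₚ-N q) (cong (-_ ∘ sinₚ ∘ toℕ) (sym (inverseˡ π))))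

  BC≡0 : ∀ i t → (B ∙ C) i t ≡ 0ℤ
  BC≡0 = on-cycle _ λ q t → trans (cycleMat-∙ 3≤n π C q t)
    (trans (cong (_+_ (C (π ⟨$⟩ʳ q) t)) (C-π-shift q t)) (ℤ.+-inverseʳ (C (π ⟨$⟩ʳ q) t)))

  -- The rows of `C` at positions 0 and 1 are (1, 0) and (0, 1), so the coordinates of AC are its
  -- entries there.
  M : Mat 2
  M zero    t = (A ∙ C) (π ⟨$⟩ʳ zero) t
  M (suc _) t = (A ∙ C) (π ⟨$⟩ʳ cycSucc zero) t

  C∙-π : ∀ (X : Mat 2) q t → (C ∙ X) (π ⟨$⟩ʳ q) t ≡ cosₚ (toℕ q) * X zero t + sinₚ (toℕ q) * X (suc zero) t
  C∙-π X q t = cong₂ _+_ (cong (λ p → cosₚ (toℕ p) * X zero t) (inverseˡ π))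
    (trans (ℤ.+-identityʳ _) (cong (λ p → sinₚ (toℕ p) * X (suc zero) t) (inverseˡ π)))

  -- B(AC) = A(BC) = 0, so each column of AC solves the recurrence of `quarter-turn`.
  AC≡CM : ∀ i t → (A ∙ C) i t ≡ (C ∙ M) i t
  AC≡CM = on-cycle _ λ q t → trans
    (quarter-turn (λ p → (A ∙ C) (π ⟨$⟩ʳ p) t) cosₚ-N sinₚ-N (λ p → begin
      (A ∙ C) (π ⟨$⟩ʳ p) t + (A ∙ C) (π ⟨$⟩ʳ cycSucc (cycSucc p)) t  ≡⟨ cycleMat-∙ 3≤n π (A ∙ C) p t ⟨
      (B ∙ (A ∙ C)) (π ⟨$⟩ʳ cycSucc p) t                             ≡⟨ BAE≡ABE C _ t ⟩
      (A ∙ (B ∙ C)) (π ⟨$⟩ʳ cycSucc p) t                             ≡⟨ sum-cong (λ j → trans (cong (A (π ⟨$⟩ʳ cycSucc p) j *_) (BC≡0 j t)) (ℤ.*-zeroʳ (A (π ⟨$⟩ʳ cycSucc p) j))) ⟩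
      sumFin {N} (λ _ → 0ℤ)                                          ≡⟨ sum-zero N ⟩
      0ℤ                                                             ∎) (cycSucc q))
    (sym (C∙-π M (cycSucc q) t))

  -- On the kernel of B only the J term of G(A) survives, and it gives every row the same value.
  CG≡const : ∀ i t → (C ∙ Gpoly 5 (suc k) M) i t ≡ sumFin (λ j → C j t)
  CG≡const i t = begin
    (C ∙ Gpoly 5 (suc k) M) i t             ≡⟨ Gpoly-intertwines A M C AC≡CM (suc k) i t ⟨
    (Gpoly 5 (suc k) A ∙ C) i t             ≡⟨ G-∙ C i t ⟩
    sumFin (λ j → C j t) + ε * (B ∙ C) i t  ≡⟨ cong (λ s → sumFin (λ j → C j t) + ε * s) (BC≡0 i t) ⟩
    sumFin (λ j → C j t) + ε * 0ℤ           ≡⟨ cong (λ s → sumFin (λ j → C j t) + s) (ℤ.*-zeroʳ ε) ⟩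
    sumFin (λ j → C j t) + 0ℤ               ≡⟨ ℤ.+-identityʳ _ ⟩
    sumFin (λ j → C j t)                    ∎

  -- The value is the same at all vertices, yet two steps along the cycle change its sign.
  CG≡0 : ∀ q t → cosₚ (toℕ q) * Gpoly 5 (suc k) M zero t + sinₚ (toℕ q) * Gpoly 5 (suc k) M (suc zero) t ≡ 0ℤ
  CG≡0 q t = trans (sym (C∙-π P q t)) (twice-zero ((C ∙ P) (π ⟨$⟩ʳ q) t) (begin
    (C ∙ P) (π ⟨$⟩ʳ q) t                               ≡⟨ trans (CG≡const _ t) (sym (CG≡const _ t)) ⟩
    (C ∙ P) (π ⟨$⟩ʳ cycSucc (cycSucc q)) t             ≡⟨ sum-cong (λ s → cong (_* P s t) (C-π-shift q s)) ⟩
    sumFin (λ s → - C (π ⟨$⟩ʳ q) s * P s t)            ≡⟨ sum-cong (λ s → trans (sym (ℤ.neg-distribˡ-* (C (π ⟨$⟩ʳ q) s) (P s t))) (sym (ℤ.-1*i≡-i (C (π ⟨$⟩ʳ q) s * P s t)))) ⟩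
    sumFin (λ s → -1ℤ * (C (π ⟨$⟩ʳ q) s * P s t))      ≡⟨ sum-*ˡ -1ℤ (λ s → C (π ⟨$⟩ʳ q) s * P s t) ⟩
    -1ℤ * (C ∙ P) (π ⟨$⟩ʳ q) t                         ≡⟨ ℤ.-1*i≡-i _ ⟩
    - (C ∙ P) (π ⟨$⟩ʳ q) t                             ∎))
    where
    P = Gpoly 5 (suc k) M

  -- Positions 0 and 1, where the rows of `C` are the unit vectors, isolate the two rows of G(M).
  GM≡0 : ∀ s t → Gpoly 5 (suc k) M s t ≡ 0ℤ
  GM≡0 zero t = trans (l₁ (Gpoly 5 (suc k) M zero t) (Gpoly 5 (suc k) M (suc zero) t)) (CG≡0 zero t)
    where
    l₁ : ∀ a b → a ≡ 1ℤ * a + 0ℤ * b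
    l₁ = solve-∀
  GM≡0 (suc zero) t = trans (l₁ _ _ _ _ (lift-cycSucc {N} cosₚ cosₚ-N zero) (lift-cycSucc {N} sinₚ sinₚ-N zero)) (CG≡0 (cycSucc zero) t)
    where
    l₂ : ∀ a b → b ≡ 0ℤ * a + 1ℤ * b
    l₂ = solve-∀
    l₁ : ∀ a b c s → c ≡ 0ℤ → s ≡ 1ℤ → b ≡ c * a + s * b
    l₁ a b _ _ refl refl = l₂ a b

  G-has-zero₂ : ¬ NoZero₂ (suc k)
  G-has-zero₂ none = none M GM≡0

-- Elimination of the remaining levels

defect-level : ∀ x y k → x ℕ.+ y ≡ 5 → 3 ≤ k → k ≤ 20000 → g (+ x - + y) k ≡ - + 2 → k ≡ 4
-- The absurd pattern makes the type checker run the recurrence and find an empty list.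
defect-level 0 .5 k refl 3≤k k≤ eq with () ← hitsUpTo20000-complete (- + 5) (- + 2) k 3≤k k≤ eq
defect-level 1 .4 k refl 3≤k k≤ eq with () ← hitsUpTo20000-complete (- + 3) (- + 2) k 3≤k k≤ eq
defect-level 2 .3 k refl 3≤k k≤ eq with () ← hitsUpTo20000-complete (- + 1) (- + 2) k 3≤k k≤ eq
-- For θ = 1 the value -2 occurs at index 4 only.
defect-level 3 .2 k refl 3≤k k≤ eq with hitsUpTo20000-complete (+ 1) (- + 2) k 3≤k k≤ eq
... | here k≡4 = k≡4
defect-level 4 .1 k refl 3≤k k≤ eq with () ← hitsUpTo20000-complete (+ 3) (- + 2) k 3≤k k≤ eq
defect-level 5 .0 k refl 3≤k k≤ eq with () ← hitsUpTo20000-complete (+ 5) (- + 2) k 3≤k k≤ eq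

excess-level : ∀ x y k → x ℕ.+ y ≡ 5 → 3 ≤ k → k ≤ 20000 → g (+ x - + y) k ≡ + 2 → k ≡ 3 ⊎ k ≡ 7
excess-level 0 .5 k refl 3≤k k≤ eq with () ← hitsUpTo20000-complete (- + 5) (+ 2) k 3≤k k≤ eq
-- For θ = -3 the value 2 occurs at indices 3 and 7, which belong to girths 7 and 15.
excess-level 1 .4 k refl 3≤k k≤ eq with hitsUpTo20000-complete (- + 3) (+ 2) k 3≤k k≤ eq
... | here k≡3         = inj₁ k≡3
... | there (here k≡7) = inj₂ k≡7
excess-level 2 .3 k refl 3≤k k≤ eq with () ← hitsUpTo20000-complete (- + 1) (+ 2) k 3≤k k≤ eq
excess-level 3 .2 k refl 3≤k k≤ eq with () ← hitsUpTo20000-complete (+ 1) (+ 2) k 3≤k k≤ eq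
excess-level 4 .1 k refl 3≤k k≤ eq with () ← hitsUpTo20000-complete (+ 3) (+ 2) k 3≤k k≤ eq
excess-level 5 .0 k refl 3≤k k≤ eq with () ← hitsUpTo20000-complete (+ 5) (+ 2) k 3≤k k≤ eq

defect-impossible : ∀ (Γ : Graph n) k → Regular 5 Γ → 3 ≤ n → (π : Permutation′ n) → 3 ≤ k → k ≤ 20000 →
                    ¬ (∀ i j → Gpoly 5 k (adjMat Γ) i j ≡ 1ℤ + 1ℤ * cycleMat π i j)
defect-impossible {suc n} Γ (suc k) regular 3≤n π 3≤k k≤ equation = case eigenvalue of λ where
    (x , y , x+y≡5 , eq) → case defect-level x y (suc k) x+y≡5 3≤k k≤ eq of λ where
      refl → G-has-zero₂ noZero₂-4
  where open CyclicEquation Γ regular 3≤n π k 1ℤ (inj₁ refl) equation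

excess-impossible : ∀ (Γ : Graph n) k → Regular 5 Γ → 3 ≤ n → (π : Permutation′ n) → 3 ≤ k → k ≤ 20000 →
                    ¬ (∀ i j → Gpoly 5 k (adjMat Γ) i j ≡ 1ℤ + -1ℤ * cycleMat π i j)
excess-impossible {suc n} Γ (suc k) regular 3≤n π 3≤k k≤ equation = case eigenvalue of λ where
    (x , y , x+y≡5 , eq) → case excess-level x y (suc k) x+y≡5 3≤k k≤ eq of λ where
      (inj₁ refl) → G-has-zero₂ noZero₂-3
      (inj₂ refl) → G-has-zero₂ noZero₂-7
  where open CyclicEquation Γ regular 3≤n π k -1ℤ (inj₂ refl) equation

theorem6 : ((n : ℕ) (Γ : Graph n) (D : ℕ) → 3 ≤ D → D ≤ 20000 → ¬ CyclicDefect 5 D Γ)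
    × ((n : ℕ) (Γ : Graph n) (g : ℕ) → Odd g → 7 ≤ g → g ≤ 40001 → ¬ CyclicExcess 5 g Γ)
theorem6 =
  (λ n Γ D 3≤D D≤ (_ , regular , _ , _ , B , (3≤n , π , B≈) , equation) →
    defect-impossible Γ D regular 3≤n π 3≤D D≤ λ i j →
      trans (equation i j) (cong (λ b → 1ℤ + b) (trans (B≈ i j) (sym (ℤ.*-identityˡ (cycleMat π i j)))))) ,
  (λ n Γ g _ 7≤g g≤ (_ , regular , _ , _ , _ , B , (3≤n , π , B≈) , equation) →
    -- Halving with rounding down turns 7 ≤ g ≤ 40001 into the range 3 to 20000 of the search.
    excess-impossible Γ (g / 2) regular 3≤n π (/-monoˡ-≤ 2 7≤g) (/-monoˡ-≤ 2 g≤) λ i j →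
      trans (equation i j) (cong (λ b → 1ℤ + b) (trans (cong -_ (B≈ i j)) (sym (ℤ.-1*i≡-i (cycleMat π i j))))))
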